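{- Let $v\ge2$ and $k\in\{5,6\}$. Then an optimum $(d,3)$-CDA$((d+1)v^3;k,v)$ exists for every positive integer $d$ with $d+1\le v$.
   Context: Consecutive $t$-way interaction in an $N\times k$ array $A=(a_{ij})$ over a $v$-set $V$: $T=\{(i,x_i),\dots,(i+t-1,x_{i+t-1})\}$, $1\le i\le k-t+1$, $x_r\in V$; $\rho(A,T)=\{r: a_{r,j}=x_j\ \forall (j,x_j)\in T\}$, $\rho(A,\mathcal T)=\bigcup_{T\in\mathcal T}\rho(A,T)$. A $(d,t)$-CDA$(N;k,v)$ is an $N\times k$ array over $V$ in which every $t$ consecutive columns contain every $t$-tuple at least once, and such that for every set $\mathcal T$ of exactly $d$ distinct consecutive $t$-way interactions and every consecutive $t$-way interaction $T$: $\rho(A,T)\subseteq\rho(A,\mathcal T)$ iff $T\in\mathcal T$. It is optimum if $N=(d+1)v^t$. -}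

module Defs where

open import Data.Nat using (ℕ; _+_; _*_; _^_; _≤_)
open import Data.Nat.Properties using (+-monoʳ-<; <-≤-trans)
open import Data.Fin using (Fin; toℕ; fromℕ<)
open import Data.Fin.Properties using (toℕ<n)
open import Data.List using (List; length)
open import Data.List.Membership.Propositional using (_∈_)
open import Data.List.Relation.Unary.Unique.Propositional using (Unique)
open import Data.Product using (∃; _×_)
open import Data.Vec using (Vec; lookup)
open import Function.Bundles using (_⇔_)
open import Level using (0ℓ)
open import Relation.Binary.PropositionalEquality using (_≡_)
open import Relation.Unary using (Pred; _⊆_)

-- The symbol set V is Fin v; rows and columns are numbered from 0.
Array : ℕ → ℕ → ℕ → Set
Array N k v = Fin N → Fin k → Fin v

-- The consecutive t-way interaction
--   {(start , x₀) , … , (start + t - 1 , xₜ₋₁)}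
-- is stored as its first column and its symbols.  For t ≥ 1 these determine
-- and are determined by the set; since the bound is irrelevant, _≡_ on the
-- record is equality of interactions.
record Interaction (t k v : ℕ) : Set where
  constructor interaction
  field
    start   : ℕ
    .fits   : start + t ≤ k
    symbols : Vec (Fin v) t

open Interaction public

column : ∀ {t k v} → Interaction t k v → Fin t → Fin k
column (interaction i i+t≤k _) j =
  fromℕ< {i + toℕ j} (<-≤-trans (+-monoʳ-< i (toℕ<n j)) i+t≤k)

ρ : ∀ {N k v t} → Array N k v → Interaction t k v → Pred (Fin N) 0ℓ
ρ A T r = ∀ j → A r (column T j) ≡ lookup (symbols T) j

-- A finite set of interactions is represented by a list (duplicate-free
-- where its cardinality matters).
ρ⋃ : ∀ {N k v t} → Array N k v → List (Interaction t k v) → Pred (Fin N) 0ℓ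
ρ⋃ A 𝒯 r = ∃ λ T → T ∈ 𝒯 × ρ A T r

-- Quantifying over interactions quantifies over all blocks of t consecutive
-- columns together with all t-tuples of symbols.
IsCovering : ∀ {N k v} → ℕ → Array N k v → Set
IsCovering {N} {k} {v} t A = (T : Interaction t k v) → ∃ λ r → ρ A T r

IsDetecting : ∀ {N k v} → ℕ → ℕ → Array N k v → Set
IsDetecting {N} {k} {v} d t A =
  (𝒯 : List (Interaction t k v)) → Unique 𝒯 → length 𝒯 ≡ d →
  (T : Interaction t k v) → (ρ A T ⊆ ρ⋃ A 𝒯) ⇔ (T ∈ 𝒯)

IsCDA : ∀ {N k v} → ℕ → ℕ → Array N k v → Set
IsCDA d t A = IsCovering t A × IsDetecting d t A

IsOptimumCDA : ∀ {N k v} → ℕ → ℕ → Array N k v → Set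
IsOptimumCDA {N} {k} {v} d t A = IsCDA d t A × N ≡ (d + 1) * v ^ t

{-# OPTIONS --safe #-}

-- Write v = n + 1.  Take as rows the quadruples x ∈ (ℤ/v)⁴ whose coordinate sum
-- lies in {0, …, d}, and let column c show the coordinate c mod 4.  Any three
-- coordinates and the value of the sum determine the fourth coordinate, so every
-- interaction lies in d + 1 rows, one for each value of the sum.  As k ≤ 6, two
-- interactions with different first columns involve all four coordinates, so at
-- most one row contains both.  Hence d interactions other than T account for at
-- most d of the d + 1 rows containing T.
module Submission where

open import Defs
open import Data.Fin using (Fin; toℕ; fromℕ<; inject≤; combine; remQuot; funToFin; finToFun)
open import Data.Fin.Properties using (_≟_; all?; any?; <⇒≢; toℕ-fromℕ<; fromℕ<-toℕ; fromℕ<-cong; toℕ<n; inject≤-injective; pigeonhole; remQuot-combine; combine-remQuot; funToFin-finToFin; finToFun-funToFin)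
open import Data.List as List using (List; length)
open import Data.List.Membership.Propositional using (_∈_)
open import Data.List.Relation.Unary.Any using (index)
open import Data.List.Relation.Unary.Any.Properties using (lookup-index)
open import Data.Nat using (ℕ; zero; suc; _+_; _*_; _^_; _≤_; _<_; z<s; s≤s)
open import Data.Nat.Divisibility using (_∣_; n∣m*n)
open import Data.Nat.DivMod using (_%_; _mod_; %-distribˡ-+; %-remove-+ˡ; m%n%n≡m%n; m<n⇒m%n≡m; m%n<n)
open import Data.Nat.Properties using (+-comm; +-assoc; *-suc; m<m+n; +-monoʳ-<; <-≤-trans; +-cancelʳ-≤; ≤-trans; ≤-refl; n≤1+n)
open import Data.Nat.Tactic.RingSolver using (solve-∀)
open import Data.Product using (Σ; ∃; _×_; _,_; proj₁; proj₂)
open import Data.Sum using (_⊎_; inj₁; inj₂)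
open import Data.Vec using (Vec; []; _∷_; lookup; tabulate)
open import Data.Vec.Properties using (tabulate-cong; tabulate∘lookup; lookup∘tabulate)
open import Function using (_∘_)
open import Function.Bundles using (mk⇔)
open import Relation.Binary.PropositionalEquality
open import Relation.Nullary using (yes; no; contradiction)
open import Relation.Nullary.Decidable using (from-yes; ¬?; _→-dec_; _⊎-dec_)
open import Relation.Unary using (_⊆_)

lookup-extensional : ∀ {a} {A : Set a} {n} {xs ys : Vec A n} → lookup xs ≗ lookup ys → xs ≡ ys
lookup-extensional {xs = xs} {ys} eq =
  trans (sym (tabulate∘lookup xs)) (trans (tabulate-cong eq) (tabulate∘lookup ys))

-- Without function extensionality, pointwise agreement has to be carried through `funToFin` by
-- hand; `encode-decode` needs this to undo `lookup` after `tabulate`.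
funToFin-cong : ∀ {m n} {f g : Fin m → Fin n} → f ≗ g → funToFin f ≡ funToFin g
funToFin-cong {zero}  eq = refl
funToFin-cong {suc m} eq = cong₂ combine (eq Fin.zero) (funToFin-cong (eq ∘ Fin.suc))

toℕ-column : ∀ {t k v} (T : Interaction t k v) j → toℕ (column T j) ≡ start T + toℕ j
toℕ-column (interaction i i+t≤k _) j = toℕ-fromℕ< (<-≤-trans (+-monoʳ-< i (toℕ<n j)) i+t≤k)

-- A sufficient condition for being a CDA

module _ {N k v t d : ℕ} (A : Array N k v)
  (rows : Interaction t k v → Fin (d + 1) → Fin N)
  (rows-ρ : ∀ T e → ρ A T (rows T e))
  (rows-injective : ∀ T {e e′} → rows T e ≡ rows T e′ → e ≡ e′)
  (ρ-superSimple : ∀ {T T′ : Interaction t k v} {r r′} → r ≢ r′ → ρ A T r → ρ A T r′ → ρ A T′ r → ρ A T′ r′ → T ≡ T′)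
  where

  d<d+1 : d < d + 1
  d<d+1 = m<m+n d z<s

  superSimple⇒isCovering : IsCovering t A
  superSimple⇒isCovering T = rows T (fromℕ< d<d+1) , rows-ρ T _

  -- Pigeonhole principle: each of the `d + 1` rows of `T` lies in a member of `𝒯`, so two of them
  -- lie in the same member. It shares two distinct rows with `T` and hence equals `T`.
  ρ⊆ρ⋃⇒∈ : ∀ (𝒯 : List (Interaction t k v)) → length 𝒯 ≡ d → ∀ T → ρ A T ⊆ ρ⋃ A 𝒯 → T ∈ 𝒯
  ρ⊆ρ⋃⇒∈ 𝒯 refl T ρ⊆ρ⋃ = subst (_∈ 𝒯) (sym T≡T′) T′∈𝒯
    where
    cover : ∀ e → ρ⋃ A 𝒯 (rows T e)
    cover e = ρ⊆ρ⋃ (rows-ρ T e)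

    -- The pigeonholes are positions in the list; equal positions then give equal interactions.
    position : Fin (d + 1) → Fin (length 𝒯)
    position e = index (proj₁ (proj₂ (cover e)))

    coverer≡ : ∀ e → proj₁ (cover e) ≡ List.lookup 𝒯 (position e)
    coverer≡ e = lookup-index (proj₁ (proj₂ (cover e)))

    collision = pigeonhole d<d+1 position
    i = proj₁ collision
    j = proj₁ (proj₂ collision)

    i≢j : i ≢ j
    i≢j = <⇒≢ (proj₁ (proj₂ (proj₂ collision)))

    T′ = proj₁ (cover i)

    T′∈𝒯 : T′ ∈ 𝒯
    T′∈𝒯 = proj₁ (proj₂ (cover i))

    T″≡T′ : proj₁ (cover j) ≡ T′
    T″≡T′ = trans (coverer≡ j)
      (trans (cong (List.lookup 𝒯) (sym (proj₂ (proj₂ (proj₂ collision))))) (sym (coverer≡ i)))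

    T≡T′ : T ≡ T′
    T≡T′ = ρ-superSimple (i≢j ∘ rows-injective T) (rows-ρ T i) (rows-ρ T j)
      (proj₂ (proj₂ (cover i)))
      (subst (λ U → ρ A U (rows T j)) T″≡T′ (proj₂ (proj₂ (cover j))))

  superSimple⇒isCDA : IsCDA d t A
  superSimple⇒isCDA = superSimple⇒isCovering , λ 𝒯 _ ∣𝒯∣≡d T →
    mk⇔ (ρ⊆ρ⋃⇒∈ 𝒯 ∣𝒯∣≡d T) (λ T∈𝒯 {r} T∋r → T , T∈𝒯 , T∋r)

-- Quadruples read cyclically

_at_ : ∀ {a} {A : Set a} → Vec A 4 → ℕ → A
w at c = lookup w (c mod 4)

-- Entries move one place later, so `rotate^ s` carries the block at positions 0, 1, 2 to the cyclic
-- block starting at `s`.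
rotate : ∀ {a} {A : Set a} → Vec A 4 → Vec A 4
rotate (a ∷ b ∷ c ∷ x ∷ []) = x ∷ a ∷ b ∷ c ∷ []

rotate^ : ∀ {a} {A : Set a} → ℕ → Vec A 4 → Vec A 4
rotate^ zero    w = w
rotate^ (suc s) w = rotate (rotate^ s w)

rotate-at : ∀ {a} {A : Set a} (w : Vec A 4) c → rotate w at suc c ≡ w at c
rotate-at (_ ∷ _ ∷ _ ∷ _ ∷ []) 0 = refl
rotate-at (_ ∷ _ ∷ _ ∷ _ ∷ []) 1 = refl
rotate-at (_ ∷ _ ∷ _ ∷ _ ∷ []) 2 = refl
rotate-at (_ ∷ _ ∷ _ ∷ _ ∷ []) 3 = refl
-- Remainders modulo 4 compute through four successors, so this goal is definitionally the one for
-- `c`.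
rotate-at w (suc (suc (suc (suc c)))) = rotate-at w c

rotate^-at : ∀ {a} {A : Set a} s (w : Vec A 4) c → rotate^ s w at (s + c) ≡ w at c
rotate^-at zero    w c = refl
rotate^-at (suc s) w c = trans (rotate-at (rotate^ s w) (s + c)) (rotate^-at s w c)

-- Each window omits only the position cyclically preceding its start, so windows with different
-- starts omit different positions. The finitely many cases are decided by evaluation.
windows-cover : (s s′ p : Fin 4) → s ≢ s′ →
  ∃ λ (j : Fin 3) → (toℕ s + toℕ j) mod 4 ≡ p ⊎ (toℕ s′ + toℕ j) mod 4 ≡ p
windows-cover = from-yes (all? λ (s : Fin 4) → all? λ (s′ : Fin 4) → all? λ (p : Fin 4) →
  ¬? (s ≟ s′) →-dec any? λ (j : Fin 3) → ((toℕ s + toℕ j) mod 4 ≟ p) ⊎-dec ((toℕ s′ + toℕ j) mod 4 ≟ p))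

two-windows-determine : ∀ {a} {A : Set a} {w w′ : Vec A 4} (s s′ : Fin 4) → s ≢ s′ →
  (∀ (j : Fin 3) → w at (toℕ s + toℕ j) ≡ w′ at (toℕ s + toℕ j)) →
  (∀ (j : Fin 3) → w at (toℕ s′ + toℕ j) ≡ w′ at (toℕ s′ + toℕ j)) → w ≡ w′
two-windows-determine {w = w} {w′} s s′ s≢s′ eq eq′ = lookup-extensional agree
  where
  agree : ∀ p → lookup w p ≡ lookup w′ p
  agree p with windows-cover s s′ p s≢s′
  ... | j , inj₁ refl = eq j
  ... | j , inj₂ refl = eq′ j

-- The check digit modulo n + 1

module _ {n : ℕ} where

  private V = Fin (suc n)

  shift : ℕ → V → V
  shift s x = (s + toℕ x) mod suc n

  shift-cancel : ∀ s t x → suc n ∣ s + t → shift s (shift t x) ≡ x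
  shift-cancel s t x v∣s+t = trans (fromℕ<-cong _ _ eq (m%n<n (s + toℕ (shift t x)) (suc n)) (toℕ<n x)) (fromℕ<-toℕ x (toℕ<n x))
    where
    open ≡-Reasoning
    eq : (s + toℕ (shift t x)) % suc n ≡ toℕ x
    eq = begin
      (s + toℕ (shift t x)) % suc n                   ≡⟨ cong (λ y → (s + y) % suc n) (toℕ-fromℕ< (m%n<n (t + toℕ x) (suc n))) ⟩
      -- Splitting the sum into remainders, collapsing the double remainder and recombining removes
      -- the inner `%`.
      (s + (t + toℕ x) % suc n) % suc n               ≡⟨ %-distribˡ-+ s _ (suc n) ⟩
      (s % suc n + (t + toℕ x) % suc n % suc n) % suc n ≡⟨ cong (λ y → (s % suc n + y) % suc n) (m%n%n≡m%n (t + toℕ x) (suc n)) ⟩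
      (s % suc n + (t + toℕ x) % suc n) % suc n       ≡⟨ %-distribˡ-+ s (t + toℕ x) (suc n) ⟨
      (s + (t + toℕ x)) % suc n                       ≡⟨ cong (_% suc n) (+-assoc s t (toℕ x)) ⟨
      (s + t + toℕ x) % suc n                         ≡⟨ %-remove-+ˡ (toℕ x) v∣s+t ⟩
      toℕ x % suc n                                   ≡⟨ m<n⇒m%n≡m (toℕ<n x) ⟩
      toℕ x                                           ∎

  -- s * n represents - s modulo n + 1.
  v∣s+sn : ∀ s → suc n ∣ s + s * n
  v∣s+sn s = subst (suc n ∣_) (*-suc s n) (n∣m*n s)

  -- The coordinate sum modulo `suc n`, written as a shift of the last coordinate so that
  -- `shift-cancel` can solve for that coordinate.
  checksum : Vec V 4 → V
  checksum (a ∷ b ∷ c ∷ x ∷ []) = shift (toℕ a + toℕ b + toℕ c) x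

  complete : V → Vec V 3 → Vec V 4
  complete e (a ∷ b ∷ c ∷ []) = a ∷ b ∷ c ∷ shift ((toℕ a + toℕ b + toℕ c) * n) e ∷ []

  take₃ : Vec V 4 → Vec V 3
  take₃ (a ∷ b ∷ c ∷ _ ∷ []) = a ∷ b ∷ c ∷ []

  take₃-complete : ∀ e xs → take₃ (complete e xs) ≡ xs
  take₃-complete e (a ∷ b ∷ c ∷ []) = refl

  checksum-complete : ∀ e xs → checksum (complete e xs) ≡ e
  checksum-complete e (a ∷ b ∷ c ∷ []) = shift-cancel s (s * n) e (v∣s+sn s)
    where s = toℕ a + toℕ b + toℕ c

  complete-checksum : ∀ w → complete (checksum w) (take₃ w) ≡ w
  complete-checksum (a ∷ b ∷ c ∷ x ∷ []) = cong (λ y → a ∷ b ∷ c ∷ y ∷ [])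
    (shift-cancel (s * n) s x (subst (suc n ∣_) (+-comm s (s * n)) (v∣s+sn s)))
    where s = toℕ a + toℕ b + toℕ c

  complete-at : ∀ e xs (j : Fin 3) → complete e xs at toℕ j ≡ lookup xs j
  complete-at e (a ∷ b ∷ c ∷ []) Fin.zero = refl
  complete-at e (a ∷ b ∷ c ∷ []) (Fin.suc Fin.zero) = refl
  complete-at e (a ∷ b ∷ c ∷ []) (Fin.suc (Fin.suc Fin.zero)) = refl

  -- This symmetry reduces a window starting anywhere to the first three coordinates.
  checksum-rotate : ∀ w → checksum (rotate w) ≡ checksum w
  checksum-rotate (a ∷ b ∷ c ∷ x ∷ []) = cong (_mod suc n) (cyclic (toℕ a) (toℕ b) (toℕ c) (toℕ x))
    where
    cyclic : ∀ a b c x → x + a + b + c ≡ a + b + c + x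
    cyclic = solve-∀

  checksum-rotate^ : ∀ s w → checksum (rotate^ s w) ≡ checksum w
  checksum-rotate^ zero    w = refl
  checksum-rotate^ (suc s) w = trans (checksum-rotate (rotate^ s w)) (checksum-rotate^ s w)

-- Rows numbered by checksum and first three coordinates

module RowCode (m v l : ℕ) where

  decode : Fin (m * v ^ l) → Fin m × Vec (Fin v) l
  decode r = let e , i = remQuot {m} (v ^ l) r in e , tabulate (finToFun i)

  encode : Fin m × Vec (Fin v) l → Fin (m * v ^ l)
  encode (e , xs) = combine e (funToFin (lookup xs))

  decode-encode : ∀ p → decode (encode p) ≡ p
  decode-encode (e , xs) = trans
    (cong (λ q → proj₁ q , tabulate (finToFun (proj₂ q))) (remQuot-combine {m} e (funToFin (lookup xs))))
    (cong (e ,_) (trans (tabulate-cong (finToFun-funToFin (lookup xs))) (tabulate∘lookup xs)))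

  encode-decode : ∀ r → encode (decode r) ≡ r
  encode-decode r = trans
    (cong (combine (proj₁ (remQuot {m} (v ^ l) r))) (trans (funToFin-cong {l} {v} (lookup∘tabulate (finToFun {v} {l} i))) (funToFin-finToFin {l} i)))
    (combine-remQuot {m} (v ^ l) r)
    where i = proj₂ (remQuot {m} (v ^ l) r)

-- The array and its super-simplicity

module _ {n d : ℕ} (d<v : d + 1 ≤ suc n) where

  open RowCode (d + 1) (suc n) 3

  -- The allowed sums 0, ..., `d` are the elements of `Fin (d + 1)` embedded in the residues; `d<v`
  -- keeps them distinct.
  word : Fin ((d + 1) * suc n ^ 3) → Vec (Fin (suc n)) 4
  word r = let e , xs = decode r in complete (inject≤ e d<v) xs

  -- The fourth coordinate, dropped by `take₃`, is recovered from the checksum.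
  word-encode : ∀ e w → checksum w ≡ inject≤ e d<v → word (encode (e , take₃ w)) ≡ w
  word-encode e w sum≡e = begin
    word (encode (e , take₃ w))          ≡⟨ cong (λ p → complete (inject≤ (proj₁ p) d<v) (proj₂ p)) (decode-encode (e , take₃ w)) ⟩
    complete (inject≤ e d<v) (take₃ w)   ≡⟨ cong (λ s → complete s (take₃ w)) sum≡e ⟨
    complete (checksum w) (take₃ w)      ≡⟨ complete-checksum w ⟩
    w                                    ∎
    where open ≡-Reasoning

  word-injective : ∀ {r r′} → word r ≡ word r′ → r ≡ r′
  word-injective {r} {r′} eq = trans (sym (encode-decode r)) (trans (cong encode (cong₂ _,_ e≡ xs≡)) (encode-decode r′))
    where
    e≡ : proj₁ (decode r) ≡ proj₁ (decode r′)
    e≡ = inject≤-injective d<v d<v _ _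
      (trans (sym (checksum-complete _ (proj₂ (decode r)))) (trans (cong checksum eq) (checksum-complete _ (proj₂ (decode r′)))))
    xs≡ : proj₂ (decode r) ≡ proj₂ (decode r′)
    xs≡ = trans (sym (take₃-complete (inject≤ (proj₁ (decode r)) d<v) _)) (trans (cong take₃ eq) (take₃-complete (inject≤ (proj₁ (decode r′)) d<v) _))

  module _ {k : ℕ} (k≤6 : k ≤ 6) where

    array : Array ((d + 1) * suc n ^ 3) k (suc n)
    array r c = word r at toℕ c

    array-column : ∀ r (T : Interaction 3 k (suc n)) j → array r (column T j) ≡ word r at (start T + toℕ j)
    array-column r T j = cong (word r at_) (toℕ-column T j)

    -- The only word with checksum `e` that shows `T`: the symbols are completed as if `T` started
    -- at column 0, then rotated into place.
    rowWord : Interaction 3 k (suc n) → Fin (d + 1) → Vec (Fin (suc n)) 4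
    rowWord T e = rotate^ (start T) (complete (inject≤ e d<v) (symbols T))

    checksum-rowWord : ∀ T e → checksum (rowWord T e) ≡ inject≤ e d<v
    checksum-rowWord T e = trans (checksum-rotate^ (start T) _) (checksum-complete _ (symbols T))

    rows : Interaction 3 k (suc n) → Fin (d + 1) → Fin ((d + 1) * suc n ^ 3)
    rows T e = encode (e , take₃ (rowWord T e))

    word-rows : ∀ T e → word (rows T e) ≡ rowWord T e
    word-rows T e = word-encode e (rowWord T e) (checksum-rowWord T e)

    rows-ρ : ∀ T e → ρ array T (rows T e)
    rows-ρ T e j = begin
      array (rows T e) (column T j)                           ≡⟨ array-column _ T j ⟩
      word (rows T e) at (start T + toℕ j)                    ≡⟨ cong (_at (start T + toℕ j)) (word-rows T e) ⟩
      rowWord T e at (start T + toℕ j)                        ≡⟨ rotate^-at (start T) _ (toℕ j) ⟩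
      complete (inject≤ e d<v) (symbols T) at toℕ j           ≡⟨ complete-at _ (symbols T) j ⟩
      lookup (symbols T) j                                    ∎
      where open ≡-Reasoning

    rows-injective : ∀ T {e e′} → rows T e ≡ rows T e′ → e ≡ e′
    rows-injective T {e} {e′} eq =
      trans (sym (cong proj₁ (decode-encode (e , take₃ (rowWord T e)))))
        (trans (cong (proj₁ ∘ decode) eq) (cong proj₁ (decode-encode (e′ , take₃ (rowWord T e′)))))

    start₄ : Interaction 3 k (suc n) → Fin 4
    -- From `s + 3 ≤ k ≤ 6` follows `s ≤ 3`, so distinct starts remain distinct modulo 4.
    start₄ (interaction s s+3≤k _) = fromℕ< {s} {4} (s≤s (+-cancelʳ-≤ 3 s 3 (≤-trans s+3≤k k≤6)))

    toℕ-start₄ : ∀ T → toℕ (start₄ T) ≡ start T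
    toℕ-start₄ (interaction s _ _) = toℕ-fromℕ< _

    words-agree : ∀ T {r r′} → ρ array T r → ρ array T r′ → (j : Fin 3) →
      word r at (toℕ (start₄ T) + toℕ j) ≡ word r′ at (toℕ (start₄ T) + toℕ j)
    words-agree T {r} {r′} T∋r T∋r′ j rewrite toℕ-start₄ T =
      trans (sym (array-column r T j)) (trans (T∋r j) (trans (sym (T∋r′ j)) (array-column r′ T j)))

    -- A single common row suffices, since its entries in the shared columns are the symbols of both
    -- interactions.
    sameStart⇒≡ : ∀ (T T′ : Interaction 3 k (suc n)) {r} → start T ≡ start T′ → ρ array T r → ρ array T′ r → T ≡ T′
    sameStart⇒≡ (interaction s fits xs) (interaction _ _ ys) refl T∋r T′∋r =
      cong (interaction s fits) (lookup-extensional λ j → trans (sym (T∋r j)) (T′∋r j))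

    array-superSimple : ∀ {T T′ : Interaction 3 k (suc n)} {r r′} → r ≢ r′ →
      ρ array T r → ρ array T r′ → ρ array T′ r → ρ array T′ r′ → T ≡ T′
    array-superSimple {T} {T′} r≢r′ T∋r T∋r′ T′∋r T′∋r′ with start₄ T ≟ start₄ T′
    ... | yes s≡s′ = sameStart⇒≡ T T′
            (trans (sym (toℕ-start₄ T)) (trans (cong toℕ s≡s′) (toℕ-start₄ T′))) T∋r T′∋r
    -- The two windows together involve all four coordinates, so the two rows would carry the same
    -- word.
    ... | no s≢s′ = contradiction
            (word-injective (two-windows-determine (start₄ T) (start₄ T′) s≢s′
              (words-agree T T∋r T∋r′) (words-agree T′ T′∋r T′∋r′)))
            r≢r′

    array-isOptimumCDA : IsOptimumCDA d 3 array
    array-isOptimumCDA = superSimple⇒isCDA array rows rows-ρ rows-injective array-superSimple , refl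

mainTheorem16 : (v k : ℕ) → 2 ≤ v → k ≡ 5 ⊎ k ≡ 6 →
    (d : ℕ) → 1 ≤ d → d + 1 ≤ v →
    Σ (Array ((d + 1) * v ^ 3) k v) (IsOptimumCDA d 3)
mainTheorem16 (suc n) k _ (inj₁ refl) d _ d<v = array d<v (n≤1+n 5) , array-isOptimumCDA d<v (n≤1+n 5)
mainTheorem16 (suc n) k _ (inj₂ refl) d _ d<v = array d<v ≤-refl , array-isOptimumCDA d<v ≤-refl
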